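{- The equation $13\cdot 3^x+13^y=z^2$ has no solutions $(x,y,z)\in\mathbb{N}^3$.
   Context: $\mathbb{N}=\{0,1,2,3,\ldots\}$ denotes the set of non-negative integers. -}

module Defs where

{-# OPTIONS --safe #-}
module Submission where

open import Data.Nat using (ℕ; _+_; _*_; _^_)
open import Relation.Nullary using (¬_)
open import Relation.Binary.PropositionalEquality using (_≡_)
open import Defs

open import Data.Fin using (Fin; toℕ)
open import Data.Fin.Properties using (all?; toℕ-fromℕ<)
open import Data.List using (List; []; _∷_)
open import Data.List.Membership.DecPropositional Data.Nat._≟_ using (_∈_; _∈?_)
import Data.List.Relation.Unary.All as All
open import Data.List.Relation.Unary.Any using (here)
open import Data.Nat using (zero; suc; NonZero; _≟_; _%_)
open import Data.Nat.DivMod using (_mod_; m%n<n; m%n%n≡m%n; %-distribˡ-+; %-distribˡ-*)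
open import Data.Nat.Properties using (*-comm; *-assoc; *-identityʳ)
open import Relation.Binary.PropositionalEquality using (refl; sym; cong; subst; _≢_; module ≡-Reasoning)
open import Relation.Nullary.Decidable using (Dec; from-yes; ¬?)

-- There is already no solution modulo 80 (for y = 0) or modulo 169 (for
-- y ≥ 1): the residues of 13·3^x and of 13^y run through short cycles, and
-- no sum of two of them is a square residue.  Modulo 80 = 16·5 the factor 16
-- forces x ≡ 3 (mod 4), and then z² ≡ 2 (mod 5).  Modulo 169, 13 ∣ z gives
-- 13 ∣ 3^x + 13^(y-1), whereas 3^x ≡ 1, 3, 9 (mod 13).

module _ (m : ℕ) .{{_ : NonZero m}} where

  Closed : ℕ → List ℕ → Set
  Closed a S = All.All (λ s → (a * s) % m ∈ S) S

  closed? : ∀ a S → Dec (Closed a S)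
  closed? a S = All.all? (λ s → (a * s) % m ∈? S) S

  -- A square modulo `m` depends only on the residue of its root, so letting `r` range over `Fin m`
  -- turns the property into a finite check.
  NonSquareSums : List ℕ → List ℕ → Set
  NonSquareSums S T =
    All.All (λ s → All.All (λ t → (r : Fin m) → (s + t) % m ≢ (toℕ r * toℕ r) % m) T) S

  nonSquareSums? : ∀ S T → Dec (NonSquareSums S T)
  nonSquareSums? S T =
    All.all? (λ s → All.all? (λ t → all? λ r → ¬? ((s + t) % m ≟ (toℕ r * toℕ r) % m)) T) S

  [a*[b%m]]%m≡[a*b]%m : ∀ a b → (a * (b % m)) % m ≡ (a * b) % m
  [a*[b%m]]%m≡[a*b]%m a b = begin
    (a * (b % m)) % m             ≡⟨ %-distribˡ-* a (b % m) m ⟩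
    ((a % m) * (b % m % m)) % m   ≡⟨ cong (λ k → ((a % m) * k) % m) (m%n%n≡m%n b m) ⟩
    ((a % m) * (b % m)) % m       ≡⟨ %-distribˡ-* a b m ⟨
    (a * b) % m                   ∎
    where open ≡-Reasoning

  -- Induction on `n`: the orbit starts in `S` and multiplying by `a` never leaves it, so one finite
  -- check covers every exponent.
  geometric-residue : ∀ {a c S} → Closed a S → c % m ∈ S → ∀ n → (c * a ^ n) % m ∈ S
  geometric-residue {c = c} {S} closed c∈S zero =
    subst (λ k → k % m ∈ S) (sym (*-identityʳ c)) c∈S
  geometric-residue {a} {c} {S} closed c∈S (suc n) =
    subst (_∈ S) shift (All.lookup closed (geometric-residue closed c∈S n))
    where
    open ≡-Reasoning
    shift : (a * ((c * a ^ n) % m)) % m ≡ (c * (a * a ^ n)) % m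
    shift = begin
      (a * ((c * a ^ n) % m)) % m   ≡⟨ [a*[b%m]]%m≡[a*b]%m a (c * a ^ n) ⟩
      (a * (c * a ^ n)) % m         ≡⟨ cong (_% m) (*-assoc a c (a ^ n)) ⟨
      (a * c * a ^ n) % m           ≡⟨ cong (λ k → (k * a ^ n) % m) (*-comm a c) ⟩
      (c * a * a ^ n) % m           ≡⟨ cong (_% m) (*-assoc c a (a ^ n)) ⟩
      (c * (a * a ^ n)) % m         ∎

  -- An equality would survive reduction modulo `m`, making `z mod m` a root that the check
  -- excludes.
  sum≢square : ∀ {S T} → NonSquareSums S T →
               ∀ u v → u % m ∈ S → v % m ∈ T → ∀ z → u + v ≢ z ^ 2
  sum≢square nonSquare u v u∈S v∈T z eq =
    All.lookup (All.lookup nonSquare u∈S) v∈T (z mod m) (begin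
      (u % m + v % m) % m                     ≡⟨ %-distribˡ-+ u v m ⟨
      (u + v) % m                             ≡⟨ cong (_% m) eq ⟩
      (z ^ 2) % m                             ≡⟨ cong (λ k → (z * k) % m) (*-identityʳ z) ⟩
      (z * z) % m                             ≡⟨ %-distribˡ-* z z m ⟩
      ((z % m) * (z % m)) % m                 ≡⟨ cong (λ k → (k * k) % m) (toℕ-fromℕ< (m%n<n z m)) ⟨
      (toℕ (z mod m) * toℕ (z mod m)) % m     ∎)
    where open ≡-Reasoning

theorem0p17 : (x y z : ℕ) → ¬ (13 * 3 ^ x + 13 ^ y ≡ z ^ 2)
theorem0p17 x zero =
  -- The cycle closes because 3 · 31 = 93 ≡ 13. Adding 1 gives 14, 40, 38, 32: the first three are
  -- 14, 8, 6 modulo 16, and 32 is 2 modulo 5.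
  sum≢square 80 (from-yes (nonSquareSums? 80 (13 ∷ 39 ∷ 37 ∷ 31 ∷ []) (1 ∷ [])))
    (13 * 3 ^ x) 1
    (geometric-residue 80 {3} {13} (from-yes (closed? 80 3 (13 ∷ 39 ∷ 37 ∷ 31 ∷ []))) (here refl) x)
    (here refl)
theorem0p17 x (suc y) =
  -- Here 3 · 117 = 351 ≡ 13 closes the cycle.
  sum≢square 169 (from-yes (nonSquareSums? 169 (13 ∷ 39 ∷ 117 ∷ []) (13 ∷ 0 ∷ [])))
    (13 * 3 ^ x) (13 ^ suc y)
    (geometric-residue 169 {3} {13} (from-yes (closed? 169 3 (13 ∷ 39 ∷ 117 ∷ []))) (here refl) x)
    -- `13 ^ suc y` unfolds to `13 * 13 ^ y`, a progression starting at 13 that is 0 modulo 169 from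
    -- its second term on.
    (geometric-residue 169 {13} {13} (from-yes (closed? 169 13 (13 ∷ 0 ∷ []))) (here refl) y)
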